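{- $gr^3_2(B_{13})=22$.
   Context: $K_n$ is the complete graph of order $n$. The book $B_n:=K_2+nK_1$ (graph join) is the graph on $n+2$ vertices consisting of an edge $xy$ (the spine) together with $n$ further, pairwise non-adjacent vertices (the pages), each adjacent to both $x$ and $y$. A $t$-coloring of $K_p$ is a map $f:E(K_p)\to\{1,\dots,t\}$, not assumed surjective. A Gallai $t$-coloring is a $t$-coloring with no rainbow triangle, i.e. there are no three vertices $x,y,z$ such that $f(xy),f(xz),f(yz)$ are pairwise distinct. For $1\le s<t$ and a graph $G$, the weakened Gallai-Ramsey number $gr^t_s(G)$ is the least $p\in\mathbb{N}$ such that every Gallai $t$-coloring of $K_p$ contains a (not necessarily induced) subgraph isomorphic to $G$ whose edges use at most $s$ colors. -}

module Defs where

open import Level using (0ℓ)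
open import Data.Nat using (ℕ; _≤_)
open import Data.Fin using (Fin)
open import Data.Fin.Subset using (Subset; _∈_; ∣_∣)
open import Data.Empty using (⊥)
open import Data.Unit using (⊤; tt)
open import Data.Product using (_×_; Σ-syntax; ∃-syntax)
open import Data.Sum using (_⊎_; inj₁; inj₂)
open import Function.Definitions using (Injective)
open import Relation.Nullary using (¬_)
open import Relation.Binary using (Rel; Symmetric)
open import Relation.Binary.PropositionalEquality
  using (_≡_; _≢_; refl; ≢-sym)

record Graph : Set₁ where
  field
    Vertex  : Set
    Adj     : Rel Vertex 0ℓ
    sym     : Symmetric Adj
    irrefl  : ∀ {v} → ¬ Adj v v

open Graph public using (Vertex; Adj)

complete : ℕ → Graph
complete n = record
  { Vertex = Fin n
  ; Adj    = _≢_
  ; sym    = ≢-sym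
  ; irrefl = λ v≢v → v≢v refl
  }

-- The graph n K₁.
edgeless : ℕ → Graph
edgeless n = record
  { Vertex = Fin n
  ; Adj    = λ _ _ → ⊥
  ; sym    = λ ()
  ; irrefl = λ ()
  }

join : Graph → Graph → Graph
join G H = record
  { Vertex = Vertex G ⊎ Vertex H
  ; Adj    = adj
  ; sym    = λ {u} {v} → adj-sym u v
  ; irrefl = λ {v} → adj-irrefl v
  }
  where
  adj : Rel (Vertex G ⊎ Vertex H) 0ℓ
  adj (inj₁ u) (inj₁ v) = Adj G u v
  adj (inj₁ _) (inj₂ _) = ⊤
  adj (inj₂ _) (inj₁ _) = ⊤
  adj (inj₂ u) (inj₂ v) = Adj H u v

  adj-sym : ∀ u v → adj u v → adj v u
  adj-sym (inj₁ _) (inj₁ _) a = Graph.sym G a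
  adj-sym (inj₁ _) (inj₂ _) _ = tt
  adj-sym (inj₂ _) (inj₁ _) _ = tt
  adj-sym (inj₂ _) (inj₂ _) a = Graph.sym H a

  adj-irrefl : ∀ v → ¬ adj v v
  adj-irrefl (inj₁ _) = Graph.irrefl G
  adj-irrefl (inj₂ _) = Graph.irrefl H

book : ℕ → Graph
book n = join (complete 2) (edgeless n)

-- A t-coloring of the edges of K_p. The edge xy is the pair x ≢ y, taken
-- in either order; the values on the diagonal carry no meaning and are
-- never consulted by the definitions below.
record Coloring (t p : ℕ) : Set where
  field
    color : Fin p → Fin p → Fin t
    sym   : ∀ x y → color x y ≡ color y x

open Coloring public using (color)

RainbowTriangle : ∀ {t p} → Coloring t p → Fin p → Fin p → Fin p → Set
RainbowTriangle f x y z =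
  (x ≢ y × x ≢ z × y ≢ z) ×
  (color f x y ≢ color f x z ×
   color f x y ≢ color f y z ×
   color f x z ≢ color f y z)

IsGallai : ∀ {t p} → Coloring t p → Set
IsGallai f = ∀ x y z → ¬ RainbowTriangle f x y z

-- A copy of G in K_p is just an injection on vertices: since any two
-- distinct vertices of K_p are adjacent, edges are preserved automatically.
record Copy (G : Graph) (p : ℕ) : Set where
  field
    embed     : Vertex G → Fin p
    injective : Injective _≡_ _≡_ embed

open Copy public using (embed)

UsesColor : ∀ {t p G} → Coloring t p → Copy G p → Fin t → Set
UsesColor {G = G} f φ c =
  ∃[ u ] ∃[ v ] (Adj G u v × color f (embed φ u) (embed φ v) ≡ c)

UsesAtMost : ∀ {t p G} → ℕ → Coloring t p → Copy G p → Set
UsesAtMost {t} s f φ =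
  Σ[ S ∈ Subset t ] (∣ S ∣ ≤ s × (∀ c → UsesColor f φ c → c ∈ S))

GallaiArrows : (t s : ℕ) → Graph → ℕ → Set
GallaiArrows t s G p =
  (f : Coloring t p) → IsGallai f → Σ[ φ ∈ Copy G p ] UsesAtMost s f φ

IsLeast : (ℕ → Set) → ℕ → Set
IsLeast P p = P p × (∀ q → P q → p ≤ q)

-- States that the weakened Gallai-Ramsey number gr^t_s(G) exists
-- and equals p. It is a relation so that no existence proof is needed to
-- define it; least elements of subsets of ℕ are unique.
IsWeakenedGallaiRamsey : (t s : ℕ) → Graph → ℕ → Set
IsWeakenedGallaiRamsey t s G p = IsLeast (GallaiArrows t s G) p

{-# OPTIONS --safe #-}

-- Upper bound.  Suppose a Gallai 3-colouring of K₂₂ has no 2-coloured B₁₃.  For an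
-- edge xy and a colour d other than its own, the pages over xy that avoid d are the
-- vertices outside N d x y, the set of those joined to x or y in colour d; so every
-- such set has at least 8 elements.  By Gallai's theorem some colour c is
-- disconnected.  Four components of colour c that cover everything, or five, are
-- excluded by size: two components together have at least 9 vertices, and a
-- component, which must be a clique of colour c, needs another one with at least 7.
-- With two or three components, one of them is joined to the rest in a single
-- colour a.  If A is the smaller side (at most 11 vertices), a Goodman-type count of
-- the triangles in the other two colours inside A shows that A is an a-clique, whence a
-- single vertex v.  Then every other vertex has degree at least 8 in both colours
-- other than a, and Gallai's theorem applied to the complement of v gives either
-- many components, excluded as before, or two sides of at least 12 vertices each.
--
-- Lower bound.  In K₂₁ join a vertex in colour 0 to five 0-coloured copies of K₄,
-- placed on the vertices of the 2-coloured K₅ without monochromatic triangle.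

module Submission where

open import Defs
open import Level using (0ℓ)
open import Data.Nat using (ℕ; zero; suc; _+_; _*_; _∸_; _≤_; _≤?_; z≤n; s≤s)
open import Data.Nat.DivMod using (_mod_)
open import Data.Nat.Properties as ℕ using ()
open import Data.Nat.Tactic.RingSolver using (solve-∀)
open import Data.Fin using (Fin; zero; suc; #_; toℕ; inject≤; punchIn; punchOut)
open import Data.Fin.Patterns using (0F; 1F; 2F; 3F; 4F)
open import Data.Fin.Properties as Fin using (_≟_; all?; any?; injective⇒≤)
open import Data.Fin.Subset as Subset using ()
open import Data.Fin.Subset.Properties as Subset using ()
open import Data.Vec using (Vec; []; _∷_; lookup)
open import Data.Product using (Σ-syntax; ∃; ∃-syntax; _×_; _,_; proj₁; proj₂)
open import Data.Sum using (_⊎_; inj₁; inj₂; [_,_]′)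
open import Data.Sum.Properties using (inj₂-injective)
open import Data.Empty using (⊥; ⊥-elim)
open import Data.Unit using (tt)
open import Function using (_∘_)
open import Function.Definitions using (Injective)
open import Relation.Nullary using (¬_; Dec; yes; no; contradiction)
open import Relation.Nullary.Decidable
  using (¬?; _×-dec_; _⊎-dec_; _→-dec_; decidable-stable; from-yes; from-no)
open import Relation.Unary using (Pred; Decidable)
open import Relation.Binary.PropositionalEquality
  using (_≡_; _≢_; refl; sym; trans; cong; cong₂; subst; ≢-sym)
open import Algebra.Properties.CommutativeMonoid.Sum ℕ.+-0-commutativeMonoid
  using (sum; sum-cong-≗; ∑-distrib-+; ∑-comm)
open import Algebra.Properties.Semiring.Sum ℕ.+-*-semiring using (*-distribˡ-sum; *-distribʳ-sum)

-- Sums over `Fin n` and cardinalities of decidable sets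

sum-mono : ∀ {n} {f g : Fin n → ℕ} → (∀ i → f i ≤ g i) → sum f ≤ sum g
sum-mono {zero}  f≤g = z≤n
sum-mono {suc n} f≤g = ℕ.+-mono-≤ (f≤g zero) (sum-mono (f≤g ∘ suc))

term≤sum : ∀ {n} (f : Fin n → ℕ) i → f i ≤ sum f
term≤sum f zero    = ℕ.m≤m+n _ _
term≤sum f (suc i) = ℕ.≤-trans (term≤sum (f ∘ suc) i) (ℕ.m≤n+m _ (f zero))

indicator : ∀ {P : Set} → Dec P → ℕ
indicator (yes _) = 1
indicator (no _)  = 0

indicator-yes : ∀ {P : Set} (P? : Dec P) → P → indicator P? ≡ 1
indicator-yes (yes _) _ = refl
indicator-yes (no ¬p) p = contradiction p ¬p

infix 4 _∈_ _∉_ _⊆_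
infixr 6 _∩_
infixr 5 _∪_

-- Sets are decidable predicates, so a membership proof is the tuple of its defining conditions and
-- an inclusion is an ordinary function.
record VSet (n : ℕ) : Set₁ where
  field
    Member  : Pred (Fin n) 0ℓ
    member? : Decidable Member

open VSet

_∈_ _∉_ : ∀ {n} → Fin n → VSet n → Set
z ∈ U = Member U z
z ∉ U = ¬ (z ∈ U)

_⊆_ : ∀ {n} → VSet n → VSet n → Set
U ⊆ W = ∀ {z} → z ∈ U → z ∈ W

Disjoint : ∀ {n} → VSet n → VSet n → Set
Disjoint U W = ∀ {z} → z ∈ U → z ∉ W

_∈?_ : ∀ {n} (z : Fin n) (U : VSet n) → Dec (z ∈ U)
z ∈? U = member? U z

⟪_⟫ : ∀ {n} {P : Pred (Fin n) 0ℓ} → Decidable P → VSet n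
⟪ P? ⟫ = record { member? = P? }

∁ : ∀ {n} → VSet n → VSet n
∁ U = ⟪ (λ z → ¬? (z ∈? U)) ⟫

_∩_ _∪_ _∖_ : ∀ {n} → VSet n → VSet n → VSet n
U ∩ W = ⟪ (λ z → z ∈? U ×-dec z ∈? W) ⟫
U ∪ W = ⟪ (λ z → z ∈? U ⊎-dec z ∈? W) ⟫
U ∖ W = U ∩ ∁ W

⁅_⁆ : ∀ {n} → Fin n → VSet n
⁅ x ⁆ = ⟪ _≟ x ⟫

χ : ∀ {n} → VSet n → Fin n → ℕ
χ U z = indicator (z ∈? U)

count : ∀ {n} → VSet n → ℕ
count U = sum (χ U)

private
  tail : ∀ {n} → VSet (suc n) → VSet n
  tail U = ⟪ (λ z → suc z ∈? U) ⟫

count-mono : ∀ {n} (U W : VSet n) → U ⊆ W → count U ≤ count W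
count-mono U W U⊆W = sum-mono pointwise
  where
  pointwise : ∀ z → indicator (z ∈? U) ≤ indicator (z ∈? W)
  pointwise z with z ∈? U
  ... | no _  = z≤n
  ... | yes p = ℕ.≤-reflexive (sym (indicator-yes (z ∈? W) (U⊆W p)))

count-∪ : ∀ {n} (U P Q : VSet n) → (∀ {z} → z ∈ U → z ∈ P ⊎ z ∈ Q) →
          count U ≤ count P + count Q
count-∪ U P Q U⊆P∪Q = ℕ.≤-trans (sum-mono pointwise) (ℕ.≤-reflexive (∑-distrib-+ (χ P) (χ Q)))
  where
  pointwise : ∀ z → indicator (z ∈? U) ≤ indicator (z ∈? P) + indicator (z ∈? Q)
  pointwise z with z ∈? U
  ... | no _  = z≤n
  ... | yes u with U⊆P∪Q u
  ...   | inj₁ p rewrite indicator-yes (z ∈? P) p = ℕ.m≤m+n _ _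
  ...   | inj₂ q rewrite indicator-yes (z ∈? Q) q = ℕ.m≤n+m _ _

count-disjoint : ∀ {n} (P Q U : VSet n) → Disjoint P Q → P ⊆ U → Q ⊆ U →
                 count P + count Q ≤ count U
count-disjoint P Q U disj P⊆U Q⊆U =
  ℕ.≤-trans (ℕ.≤-reflexive (sym (∑-distrib-+ (χ P) (χ Q)))) (sum-mono pointwise)
  where
  pointwise : ∀ z → indicator (z ∈? P) + indicator (z ∈? Q) ≤ indicator (z ∈? U)
  pointwise z with z ∈? P | z ∈? Q
  ... | yes p | yes q = contradiction q (disj p)
  ... | yes p | no _  = ℕ.≤-reflexive (sym (indicator-yes (z ∈? U) (P⊆U p)))
  ... | no _  | yes q = ℕ.≤-reflexive (sym (indicator-yes (z ∈? U) (Q⊆U q)))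
  ... | no _  | no _  = z≤n

sum-count-disjoint : ∀ {m n} (K : Fin m → VSet n) (U : VSet n) →
  (∀ {i j} → i ≢ j → Disjoint (K i) (K j)) → (∀ i → K i ⊆ U) →
  sum (count ∘ K) ≤ count U
sum-count-disjoint {zero}  K U disj K⊆U = z≤n
sum-count-disjoint {suc m} K U disj K⊆U = ℕ.≤-trans
  (ℕ.+-monoʳ-≤ (count (K zero))
    (sum-count-disjoint (K ∘ suc) (U ∖ K zero) (λ i≢j → disj (i≢j ∘ Fin.suc-injective))
      (λ i z∈K → K⊆U (suc i) z∈K , disj (λ ()) z∈K)))
  (count-disjoint (K zero) (U ∖ K zero) U (λ z∈K z∈∖ → proj₂ z∈∖ z∈K) (K⊆U zero) proj₁)

-- Turns a lower bound on a cardinality into that many distinct members; this later supplies the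
-- pages of a book.
select : ∀ {m n} (U : VSet n) → m ≤ count U →
         Σ[ g ∈ (Fin m → Fin n) ] (Injective _≡_ _≡_ g × (∀ i → g i ∈ U))
select {zero}          U _ = (λ ()) , (λ { {()} }) , λ ()
select {suc m} {suc n} U m<∣U∣ with zero ∈? U
... | no _ = let (g , inj , g∈U) = select (tail U) m<∣U∣
             in suc ∘ g , inj ∘ Fin.suc-injective , g∈U
... | yes 0∈U with select (tail U) (ℕ.≤-pred m<∣U∣)
...   | g , inj , g∈U = g′ , inj′ , g′∈U
  where
  g′ : Fin (suc m) → Fin (suc n)
  g′ zero    = zero
  g′ (suc i) = suc (g i)
  inj′ : Injective _≡_ _≡_ g′
  inj′ {zero}  {zero}  _ = refl
  inj′ {suc i} {suc j} e = cong suc (inj (Fin.suc-injective e))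
  g′∈U : ∀ i → g′ i ∈ U
  g′∈U zero    = 0∈U
  g′∈U (suc i) = g∈U i

-- Members are numbered by their position in `U`; composed with an injection into `U`, this reduces
-- `injective⇒≤count` to the pigeonhole principle on `Fin`.
rank : ∀ {n} (U : VSet n) → Σ[ r ∈ (∀ z → z ∈ U → Fin (count U)) ]
       (∀ {y z} (p : y ∈ U) (q : z ∈ U) → r y p ≡ r z q → y ≡ z)
rank {zero}  U = (λ ()) , (λ { {()} })
rank {suc n} U with zero ∈? U | rank (tail U)
... | no 0∉U | r , inj = r′ , inj′
  where
  r′ : ∀ z → z ∈ U → Fin (count (tail U))
  r′ zero    p = contradiction p 0∉U
  r′ (suc z) p = r z p
  inj′ : ∀ {y z} (p : y ∈ U) (q : z ∈ U) → r′ y p ≡ r′ z q → y ≡ z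
  inj′ {zero}          p q e = contradiction p 0∉U
  inj′ {suc y} {zero}  p q e = contradiction q 0∉U
  inj′ {suc y} {suc z} p q e = cong suc (inj p q e)
... | yes _ | r , inj = r′ , inj′
  where
  r′ : ∀ z → z ∈ U → Fin (suc (count (tail U)))
  r′ zero    p = zero
  r′ (suc z) p = suc (r z p)
  inj′ : ∀ {y z} (p : y ∈ U) (q : z ∈ U) → r′ y p ≡ r′ z q → y ≡ z
  inj′ {zero}  {zero}  p q e = refl
  inj′ {suc y} {suc z} p q e = cong suc (inj p q (Fin.suc-injective e))

injective⇒≤count : ∀ {m n} (U : VSet n) (g : Fin m → Fin n) → Injective _≡_ _≡_ g →
                   (∀ i → g i ∈ U) → m ≤ count U
injective⇒≤count U g g-inj g∈U =
  injective⇒≤ {f = λ i → proj₁ (rank U) (g i) (g∈U i)} (g-inj ∘ proj₂ (rank U) _ _)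

count≤n : ∀ {n} (U : VSet n) → count U ≤ n
count≤n U = injective⇒≤ (proj₁ (proj₂ (select U ℕ.≤-refl)))

∈⇒1≤count : ∀ {n z} (U : VSet n) → z ∈ U → 1 ≤ count U
∈⇒1≤count U z∈U = injective⇒≤count {1} U _ (λ { {zero} {zero} _ → refl }) (λ _ → z∈U)

count-insert : ∀ {n x} (W U : VSet n) → x ∈ U → x ∉ W → W ⊆ U → suc (count W) ≤ count U
count-insert {x = x} W U x∈U x∉W W⊆U = ℕ.≤-trans
  (ℕ.+-monoˡ-≤ (count W) (∈⇒1≤count ⁅ x ⁆ refl))
  (count-disjoint ⁅ x ⁆ W U (λ { refl → x∉W }) (λ { refl → x∈U }) W⊆U)

inhabited : ∀ {n} (U : VSet n) → 1 ≤ count U → ∃ (_∈ U)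
inhabited U 1≤ = let (g , _ , g∈U) = select {1} U 1≤ in g zero , g∈U zero

count-empty : ∀ {n} (U : VSet n) → (∀ {z} → z ∉ U) → count U ≡ 0
count-empty U ∉U = ℕ.n<1⇒n≡0 (ℕ.≰⇒> (λ 1≤ → ∉U (proj₂ (inhabited U 1≤))))

count⁅_⁆≤1 : ∀ {n} (x : Fin n) → count ⁅ x ⁆ ≤ 1
count⁅ x ⁆≤1 = ℕ.≮⇒≥ two
  where
  two : ¬ (2 ≤ count ⁅ x ⁆)
  two 2≤ with select ⁅ x ⁆ 2≤
  ... | g , inj , g∈ with inj {zero} {suc zero} (trans (g∈ zero) (sym (g∈ (suc zero))))
  ...   | ()

full : ∀ {n} → VSet n
full = ⟪ (λ _ → yes tt) ⟫

-- Three colours and reorderings of indices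

others : (c : Fin 3) → ∃[ a ] ∃[ b ] (a ≢ b × a ≢ c × b ≢ c)
others zero             = # 1 , # 2 , (λ ()) , (λ ()) , λ ()
others (suc zero)       = # 0 , # 2 , (λ ()) , (λ ()) , λ ()
others (suc (suc zero)) = # 0 , # 1 , (λ ()) , (λ ()) , λ ()

third : (a b : Fin 3) → ∃[ d ] (d ≢ a × d ≢ b)
third a b with others a
... | p , q , p≢q , p≢a , q≢a with p ≟ b
...   | no p≢b   = p , p≢a , p≢b
...   | yes refl = q , q≢a , ≢-sym p≢q

-- Lists `i` first and the other indices after it, so that any component can take the place of
-- number 0.
front : ∀ {m} → Fin (suc m) → Fin (suc m) → Fin (suc m)
front i zero    = i
front i (suc k) = punchIn i k

front-injective : ∀ {m} (i : Fin (suc m)) j k → j ≢ k → front i j ≢ front i k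
front-injective i zero    zero    j≢k _ = j≢k refl
front-injective i zero    (suc k) _   e = Fin.punchInᵢ≢i i k (sym e)
front-injective i (suc j) zero    _   e = Fin.punchInᵢ≢i i j e
front-injective i (suc j) (suc k) j≢k e = j≢k (cong suc (Fin.punchIn-injective i j k e))

front-surjective : ∀ {m} (i k : Fin (suc m)) → ∃[ j ] front i j ≡ k
front-surjective i k with i ≟ k
... | yes i≡k = zero , i≡k
... | no i≢k  = suc (punchOut i≢k) , Fin.punchIn-punchOut i≢k

-- Three values lie among the two colours other than `c`, so one of these colours occurs at most
-- once; `j` is its only possible position.
minority : (g : Fin 3 → Fin 3) (c : Fin 3) →
           (∀ l → g l ≢ c) → ∃[ d ] ∃[ j ] (d ≢ c × (∀ l → g l ≡ d → l ≡ j))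
minority g c g≢c with g (# 0) ≟ g (# 1) | g (# 0) ≟ g (# 2)
... | no 0≢1 | no 0≢2 = g (# 0) , # 0 , g≢c _ , λ
  { zero _ → refl
  ; (suc zero) e → contradiction (sym e) 0≢1
  ; (suc (suc zero)) e → contradiction (sym e) 0≢2 }
... | no 0≢1 | yes 0≡2 = g (# 1) , # 1 , g≢c _ , λ
  { zero e → contradiction e 0≢1
  ; (suc zero) _ → refl
  ; (suc (suc zero)) e → contradiction (trans 0≡2 e) 0≢1 }
... | yes 0≡1 | _ with third c (g (# 0))
...   | d , d≢c , d≢0 = d , # 2 , d≢c , λ
  { zero e → contradiction (sym e) d≢0
  ; (suc zero) e → contradiction (sym (trans 0≡1 e)) d≢0
  ; (suc (suc zero)) _ → refl }

-- Tools for the triangle count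

am-gm : ∀ p q → 2 * (p * q + q * p) ≤ (p + q) * (p + q)
am-gm p q = [ ordered p q , (λ q≤p → ℕ.≤-trans
    (ℕ.≤-reflexive (cong (2 *_) (ℕ.+-comm (p * q) (q * p))))
    (ℕ.≤-trans (ordered q p q≤p) (ℕ.≤-reflexive (cong (λ s → s * s) (ℕ.+-comm q p))))) ]′
  (ℕ.≤-total p q)
  where
  -- With the larger number written as `p + k`, the two sides differ by `k * k`.
  square : ∀ p k → 2 * (p * (p + k) + (p + k) * p) + k * k ≡ (p + (p + k)) * (p + (p + k))
  square = solve-∀
  ordered : ∀ p q → p ≤ q → 2 * (p * q + q * p) ≤ (p + q) * (p + q)
  ordered p q p≤q = subst (λ q → 2 * (p * q + q * p) ≤ (p + q) * (p + q)) (ℕ.m+[n∸m]≡n p≤q)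
    (ℕ.≤-trans (ℕ.m≤m+n _ ((q ∸ p) * (q ∸ p))) (ℕ.≤-reflexive (square p (q ∸ p))))

∑³ : ∀ {n} → (Fin n → Fin n → Fin n → ℕ) → ℕ
∑³ F = sum λ x → sum λ y → sum λ z → F x y z

∑³-mono : ∀ {n} {F G : Fin n → Fin n → Fin n → ℕ} → (∀ x y z → F x y z ≤ G x y z) → ∑³ F ≤ ∑³ G
∑³-mono F≤G = sum-mono λ x → sum-mono λ y → sum-mono λ z → F≤G x y z

∑³-+ : ∀ {n} (F G : Fin n → Fin n → Fin n → ℕ) →
       ∑³ (λ x y z → F x y z + G x y z) ≡ ∑³ F + ∑³ G
∑³-+ F G = trans
  (sum-cong-≗ λ x → trans (sum-cong-≗ λ y → ∑-distrib-+ (F x y) (G x y))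
    (∑-distrib-+ (λ y → sum (F x y)) (λ y → sum (G x y))))
  (∑-distrib-+ (λ x → sum λ y → sum (F x y)) (λ x → sum λ y → sum (G x y)))

-- This and the rotation below rename the variables of a triple sum, so that a cherry may be centred
-- at any of its three vertices.
∑³-swap : ∀ {n} (F : Fin n → Fin n → Fin n → ℕ) → ∑³ (λ x y z → F y x z) ≡ ∑³ F
∑³-swap F = ∑-comm (λ x y → sum (F y x))

∑³-rotate : ∀ {n} (F : Fin n → Fin n → Fin n → ℕ) → ∑³ (λ x y z → F z x y) ≡ ∑³ F
∑³-rotate F = trans (sum-cong-≗ λ x → ∑-comm (λ y z → F z x y)) (∑-comm (λ x z → sum (F z x)))

-- Components of one colour and Gallai's theorem

module GallaiColoring {n} (f : Coloring 3 n) (gallai : IsGallai f) where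

  col : Fin n → Fin n → Fin 3
  col = color f

  col-sym : ∀ x y → col x y ≡ col y x
  col-sym = Coloring.sym f

  non-rainbow : ∀ {x y z} → x ≢ y → x ≢ z → y ≢ z →
                col x y ≢ col x z → col y z ≢ col x y → col x z ≡ col y z
  non-rainbow {x} {y} {z} x≢y x≢z y≢z xy≢xz yz≢xy =
    decidable-stable (col x z ≟ col y z)
      (λ xz≢yz → gallai x y z ((x≢y , x≢z , y≢z) , (xy≢xz , ≢-sym yz≢xy , xz≢yz)))

  -- U is a union of components of the subgraph of S in colour c.
  Closed : Fin 3 → VSet n → VSet n → Set
  Closed c S U = ∀ u z → u ∈ U → z ∈ S → z ∉ U → col u z ≢ c

  Closed-∖ : ∀ {c} S U → U ⊆ S → Closed c S U → Closed c S (S ∖ U)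
  Closed-∖ S U U⊆S cl u z (u∈S , u∉U) z∈S z∉ =
    cl z u (decidable-stable (z ∈? U) (λ z∉U → z∉ (z∈S , z∉U))) u∈S u∉U ∘ trans (col-sym z u)

  record Split (c : Fin 3) (S : VSet n) : Set₁ where
    field
      {part}      : VSet n
      part⊆       : part ⊆ S
      {in₁ out₁}  : Fin n
      in-part     : in₁ ∈ part
      out-S       : out₁ ∈ S
      out-part    : out₁ ∉ part
      part-closed : Closed c S part

  -- The universal property replaces paths: a claim about every vertex of the component follows once
  -- the vertices satisfying it form a closed set containing `x`.
  record Component (c : Fin 3) (S : VSet n) (x : Fin n) : Set₁ where
    field
      body   : VSet n
      centre : x ∈ body
      body⊆  : body ⊆ S
      closed : Closed c S body
      least  : ∀ W → x ∈ W → Closed c S W → body ⊆ W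

  component : ∀ c S {x} → x ∈ S → Component c S x
  component c S {x} x∈S = grow n ⁅ x ⁆ (count≤n _) refl (λ { refl → x∈S })
                               (λ { W x∈W _ refl → x∈W })
    where
    -- `k` bounds the number of vertices of `S` still outside `U`; each round adds one vertex joined
    -- to `U` in colour `c`.
    grow : ∀ k U → count (S ∖ U) ≤ k → x ∈ U → U ⊆ S →
           (∀ W → x ∈ W → Closed c S W → U ⊆ W) → Component c S x
    grow k U ∣S∖U∣≤k x∈U U⊆S least
      with any? (λ u → any? (λ z → u ∈? U ×-dec z ∈? (S ∖ U) ×-dec col u z ≟ c))
    ... | no none = record
      { body = U ; centre = x∈U ; body⊆ = U⊆S ; least = least
      ; closed = λ _ _ u∈U z∈S z∉U uz≡c → none (_ , _ , u∈U , (z∈S , z∉U) , uz≡c) }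
    grow zero U ∣S∖U∣≤k x∈U U⊆S least | yes (u , z , _ , z∈ , _) =
      contradiction (ℕ.≤-trans (∈⇒1≤count (S ∖ U) z∈) ∣S∖U∣≤k) λ ()
    grow (suc k) U ∣S∖U∣≤k x∈U U⊆S least | yes (u , z , u∈U , z∈@(z∈S , z∉U) , uz≡c) =
      grow k (U ∪ ⁅ z ⁆) (ℕ.≤-pred (ℕ.≤-trans shrinks ∣S∖U∣≤k)) (inj₁ x∈U)
        (λ { (inj₁ p) → U⊆S p ; (inj₂ refl) → z∈S })
        (λ { W x∈W cl (inj₁ p) → least W x∈W cl p
           ; W x∈W cl (inj₂ refl) → decidable-stable (z ∈? W)
               (λ z∉W → cl u z (least W x∈W cl u∈U) z∈S z∉W uz≡c) })
      where
      shrinks : suc (count (S ∖ (U ∪ ⁅ z ⁆))) ≤ count (S ∖ U)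
      shrinks = count-insert (S ∖ (U ∪ ⁅ z ⁆)) (S ∖ U) z∈ (λ (_ , z∉) → z∉ (inj₂ refl))
                  (λ (p , q) → p , q ∘ inj₁)

  module _ {c S x} (X : Component c S x) where
    open Component X

    least-∖ : ∀ U → Closed c S U → U ⊆ S → x ∈ S → x ∉ U → Disjoint body U
    least-∖ U cl U⊆S x∈S x∉U p = proj₂ (least (S ∖ U) (x∈S , x∉U) (Closed-∖ S U U⊆S cl) p)

    -- The vertices of the component that agree with `x` about `z` form a closed set: across an edge
    -- `u s` of colour `c`, neither `u z` nor `s z` has colour `c`, so the Gallai condition makes
    -- them equal.
    homogeneous : ∀ {u z} → u ∈ body → z ∈ S → z ∉ body → col u z ≡ col x z
    homogeneous {z = z} u∈ z∈S z∉ = proj₂ (least W (centre , refl) W-closed u∈)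
      where
      W : VSet n
      W = body ∩ ⟪ (λ u → col u z ≟ col x z) ⟫
      W-closed : Closed c S W
      W-closed u s (u∈X , uz≡) s∈S s∉W us≡c with s ∈? body
      ... | no s∉X  = closed _ _ u∈X s∈S s∉X us≡c
      ... | yes s∈X = s∉W (s∈X , trans (sym (non-rainbow u≢s u≢z s≢z us≢uz sz≢us)) uz≡)
        where
        u≢s : u ≢ s
        u≢s refl = s∉W (u∈X , uz≡)
        u≢z : u ≢ z
        u≢z refl = z∉ u∈X
        s≢z : s ≢ z
        s≢z refl = z∉ s∈X
        us≢uz : col u s ≢ col u z
        us≢uz e = closed _ _ u∈X z∈S z∉ (trans (sym e) us≡c)
        sz≢us : col s z ≢ col u s
        sz≢us e = closed _ _ s∈X z∈S z∉ (trans e us≡c)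

  -- Inductive step of Gallai's theorem. If `c` split the set without `v`, then `v` would have
  -- neighbours `p` and `q` in the other two colours, and these would force both colours on one edge
  -- leaving the component of `p`.
  unsplit-∖ : ∀ {S v} → v ∈ S → (∀ c → ¬ Split c S) → ∀ c → ¬ Split c (S ∖ ⁅ v ⁆)
  unsplit-∖ {S} {v} v∈S unsplit c sp with others c
  ... | a , b , a≢b , a≢c , b≢c with neighbour a | neighbour b
    where
    open Split sp
    -- Without such a neighbour, `⁅ v ⁆` itself would be split off in colour `d`.
    neighbour : ∀ d → ∃[ u ] (u ∈ S ∖ ⁅ v ⁆ × col v u ≡ d)
    neighbour d = decidable-stable (any? (λ u → u ∈? (S ∖ ⁅ v ⁆) ×-dec col v u ≟ d)) λ none →
      unsplit d record
        { part = ⁅ v ⁆ ; part⊆ = λ { refl → v∈S } ; in-part = refl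
        ; out-S = proj₁ out-S ; out-part = proj₂ out-S
        ; part-closed = λ { _ _ refl z∈S z≢v vz≡d → none (_ , (z∈S , z≢v) , vz≡d) } }
  ... | p , p∈ , vp≡a | q , q∈ , vq≡b = ⊥-elim impossible
    where
    open Split sp
    S′ : VSet n
    S′ = S ∖ ⁅ v ⁆
    -- A closed `W` without a `c`-neighbour of `v` would stay closed after `v` is put back.
    c-neighbour : ∀ W {w} → W ⊆ S′ → w ∈ W → Closed c S′ W → ∃[ u ] (u ∈ W × col v u ≡ c)
    c-neighbour W W⊆S′ w∈W cl =
      decidable-stable (any? (λ u → u ∈? W ×-dec col v u ≟ c)) λ none →
        unsplit c record
          { part = W ; part⊆ = proj₁ ∘ W⊆S′ ; in-part = w∈W ; out-S = v∈S
          ; out-part = λ v∈W → proj₂ (W⊆S′ v∈W) refl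
          ; part-closed = λ u z u∈W z∈S z∉W uz≡c → closed-S none u∈W z∈S z∉W uz≡c (z ≟ v) }
      where
      closed-S : ¬ (∃[ u ] (u ∈ W × col v u ≡ c)) →
                 ∀ {u z} → u ∈ W → z ∈ S → z ∉ W → col u z ≡ c → Dec (z ≡ v) → ⊥
      closed-S none u∈W _ _ uz≡c (yes refl) = none (_ , u∈W , trans (col-sym v _) uz≡c)
      closed-S none u∈W z∈S z∉W uz≡c (no z≢v) = cl _ _ u∈W (z∈S , z≢v) z∉W uz≡c
    -- The component of z contains a c-neighbour w of v, and the triangle v, u, w
    -- forces u w, hence u z, to have the colour of v u.
    spread : ∀ {d u z} U → d ≢ c → U ⊆ S′ → Closed c S′ U →
             u ∈ U → col v u ≡ d → z ∈ S′ → z ∉ U → col u z ≡ d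
    spread {d} {u} {z} U d≢c U⊆S′ cl u∈U vu≡d z∈S′ z∉U = conclude
      (c-neighbour Z.body Z.body⊆ Z.centre Z.closed)
      where
      Z : Component c S′ z
      Z = component c S′ z∈S′
      module Z = Component Z
      Z∥U : Disjoint Z.body U
      Z∥U = least-∖ Z U cl U⊆S′ z∈S′ z∉U
      conclude : ∃[ w ] (w ∈ Z.body × col v w ≡ c) → col u z ≡ d
      conclude (w , w∈Z , vw≡c) = trans (col-sym u z) (trans (sym wu≡zu) (trans (sym vu≡wu) vu≡d))
        where
        u∉Z : u ∉ Z.body
        u∉Z u∈Z = Z∥U u∈Z u∈U
        w≢u : w ≢ u
        w≢u refl = u∉Z w∈Z
        wu≡zu : col w u ≡ col z u
        wu≡zu = homogeneous Z w∈Z (U⊆S′ u∈U) u∉Z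
        wu≢c : col w u ≢ c
        wu≢c = Z.closed w u w∈Z (U⊆S′ u∈U) u∉Z
        vu≡wu : col v u ≡ col w u
        vu≡wu = non-rainbow (≢-sym (proj₂ (Z.body⊆ w∈Z))) (≢-sym (proj₂ (U⊆S′ u∈U))) w≢u
          (λ e → d≢c (trans (sym vu≡d) (trans (sym e) vw≡c))) (λ e → wu≢c (trans e vw≡c))
    X : Component c S′ p
    X = component c S′ p∈
    module X = Component X
    outside : ∃[ z ] (z ∈ S′ × z ∉ X.body)
    outside with p ∈? part
    ... | yes p∈U = _ , out-S , out-part ∘ X.least part p∈U part-closed
    ... | no p∉U  = _ , part⊆ in-part , λ i → least-∖ X part part-closed part⊆ p∈ p∉U i in-part
    -- If `q` lies outside `X`, the contested edge is `p q`; otherwise it is `q z` with `z` outside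
    -- `X`, where `homogeneous` carries colour `a` over from `p z`.
    impossible : ⊥
    impossible with q ∈? X.body | outside
    ... | no q∉X  | _ = a≢b (trans
      (sym (spread X.body a≢c X.body⊆ X.closed X.centre vp≡a q∈ q∉X))
      (trans (col-sym p q)
        (spread (S′ ∖ X.body) b≢c proj₁ (Closed-∖ S′ X.body X.body⊆ X.closed) (q∈ , q∉X) vq≡b p∈
          (λ r → proj₂ r X.centre))))
    ... | yes q∈X | z , z∈ , z∉X = a≢b (trans
      (sym (spread X.body a≢c X.body⊆ X.closed X.centre vp≡a z∈ z∉X))
      (trans (sym (homogeneous X q∈X z∈ z∉X))
        (spread X.body b≢c X.body⊆ X.closed q∈X vq≡b z∈ z∉X)))

  -- Gallai's theorem in refutation form. Vertices other than `x` and `y` are deleted one by one; at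
  -- the end a single edge is left, and any colour not on it separates its ends.
  some-split : ∀ S {x y} → x ∈ S → y ∈ S → x ≢ y → (∀ c → ¬ Split c S) → ⊥
  some-split S {x} {y} x∈S y∈S x≢y = go n S (count≤n S) x∈S y∈S
    where
    go : ∀ k T → count T ≤ k → x ∈ T → y ∈ T → (∀ c → ¬ Split c T) → ⊥
    go zero T ∣T∣≤0 x∈T _ _ = contradiction (ℕ.≤-trans (∈⇒1≤count T x∈T) ∣T∣≤0) λ ()
    go (suc k) T ∣T∣≤k x∈T y∈T unsplit
      with any? (λ v → v ∈? T ×-dec ¬? (v ≟ x) ×-dec ¬? (v ≟ y))
    ... | yes (v , v∈T , v≢x , v≢y) =
      go k (T ∖ ⁅ v ⁆)
        (ℕ.≤-pred (ℕ.≤-trans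
          (count-insert (T ∖ ⁅ v ⁆) T v∈T (λ p → proj₂ p refl) proj₁) ∣T∣≤k))
        (x∈T , ≢-sym v≢x) (y∈T , ≢-sym v≢y) (unsplit-∖ v∈T unsplit)
    ... | no none with others (col x y)
    ...   | a , _ , _ , a≢xy , _ = unsplit a record
      { part = ⁅ x ⁆ ; part⊆ = λ { refl → x∈T } ; in-part = refl ; out-S = y∈T ; out-part = ≢-sym x≢y
      ; part-closed = only }
      where
      only : ∀ u z → u ∈ ⁅ x ⁆ → z ∈ T → z ∉ ⁅ x ⁆ → col u z ≢ a
      only _ z refl z∈T z≢x xz≡a with z ≟ y
      ... | yes refl = a≢xy (sym xz≡a)
      ... | no z≢y   = none (z , z∈T , z≢x , z≢y)

  -- Homogeneous splits and families of components

  record HomogeneousSplit (d : Fin 3) (S : VSet n) : Set₁ where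
    field
      {part}     : VSet n
      part⊆      : part ⊆ S
      {in₁ out₁} : Fin n
      in-part    : in₁ ∈ part
      out-S      : out₁ ∈ S
      out-part   : out₁ ∉ part
      uniform    : ∀ u z → u ∈ part → z ∈ S → z ∉ part → col u z ≡ d

  -- Representatives of `m` different components; whether these exhaust `S` is left to `Covers`.
  record Family (c : Fin 3) (S : VSet n) (m : ℕ) : Set where
    field
      rep       : Fin m → Fin n
      rep∈      : ∀ i → rep i ∈ S
      separated : ∀ i j → i ≢ j → rep i ∉ Component.body (component c S (rep∈ j))

    comp : ∀ i → Component c S (rep i)
    comp i = component c S (rep∈ i)

    body : Fin m → VSet n
    body i = Component.body (comp i)

    centre : ∀ i → rep i ∈ body i
    centre i = Component.centre (comp i)

    body⊆ : ∀ i → body i ⊆ S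
    body⊆ i = Component.body⊆ (comp i)

    closed : ∀ i → Closed c S (body i)
    closed i = Component.closed (comp i)

    disjoint : ∀ i j → i ≢ j → Disjoint (body i) (body j)
    disjoint i j i≢j =
      least-∖ (comp i) (body j) (closed j) (body⊆ j) (rep∈ i) (separated i j i≢j)

    across : ∀ i j {u z} → i ≢ j → u ∈ body i → z ∈ body j → col u z ≡ col (rep i) (rep j)
    across i j {u} {z} i≢j u∈ z∈ = trans
      (homogeneous (comp i) u∈ (body⊆ j z∈) (λ z∈i → disjoint i j i≢j z∈i z∈))
      (trans (col-sym _ z) (trans
        (homogeneous (comp j) z∈ (rep∈ i) (separated i j i≢j)) (col-sym _ _)))

    across≢ : ∀ i j → i ≢ j → col (rep i) (rep j) ≢ c
    across≢ i j i≢j = closed i _ _ (centre i) (rep∈ j) (separated j i (≢-sym i≢j))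

    rep-injective : ∀ i j → i ≢ j → rep i ≢ rep j
    rep-injective i j i≢j e = separated i j i≢j (subst (_∈ body j) (sym e) (centre j))

    Covers : Set
    Covers = ∀ z → z ∈ S → ∃[ i ] z ∈ body i

    sizes : sum (λ i → count (body i)) ≤ count S
    sizes = sum-count-disjoint body S (λ {i} {j} → disjoint i j) body⊆

  open Family

  reindex : ∀ {c S m k} → Family c S m → (π : Fin k → Fin m) → (∀ i j → i ≢ j → π i ≢ π j) →
            Family c S k
  reindex F π π-inj = record
    { rep = rep F ∘ π ; rep∈ = rep∈ F ∘ π
    ; separated = λ i j i≢j → separated F (π i) (π j) (π-inj i j i≢j) }

  extend : ∀ {c S m z} (F : Family c S m) → z ∈ S → (∀ i → z ∉ body F i) → Family c S (suc m)
  extend {c} {S} {m} {z} F z∈S z∉F = record { rep = rep′ ; rep∈ = rep′∈ ; separated = separated′ }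
    where
    rep′ : Fin (suc m) → Fin n
    rep′ zero    = z
    rep′ (suc i) = rep F i
    rep′∈ : ∀ i → rep′ i ∈ S
    rep′∈ zero    = z∈S
    rep′∈ (suc i) = rep∈ F i
    separated′ : ∀ i j → i ≢ j → rep′ i ∉ Component.body (component c S (rep′∈ j))
    separated′ zero    zero    0≢0 = contradiction refl 0≢0
    separated′ zero    (suc j) _   = z∉F j
    separated′ (suc i) zero    _   p =
      least-∖ (component c S z∈S) (body F i) (closed F i) (body⊆ F i) z∈S (z∉F i) p (centre F i)
    separated′ (suc i) (suc j) i≢j = separated F i j (i≢j ∘ cong suc)

  covers-or-extends : ∀ {c S m} (F : Family c S m) → Covers F ⊎ Family c S (suc m)
  covers-or-extends {S = S} F with any? (λ z → z ∈? S ×-dec ¬? (any? (λ i → z ∈? body F i)))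
  ... | yes (z , z∈S , z∉) = inj₂ (extend F z∈S (λ i z∈i → z∉ (i , z∈i)))
  ... | no none = inj₁ (λ z z∈S → decidable-stable (any? (λ i → z ∈? body F i))
                                    (λ z∉ → none (z , z∈S , z∉)))

  isolate : ∀ {c S m d} (F : Family c S m) → Covers F → ∀ i j → j ≢ i →
            (∀ k → k ≢ i → col (rep F i) (rep F k) ≡ d) → HomogeneousSplit d S
  isolate {S = S} {d = d} F covers i j j≢i same = record
    { part = body F i ; part⊆ = body⊆ F i ; in-part = centre F i ; out-S = rep∈ F j
    ; out-part = separated F j i j≢i ; uniform = uniform′ }
    where
    uniform′ : ∀ u z → u ∈ body F i → z ∈ S → z ∉ body F i → col u z ≡ d
    uniform′ u z u∈ z∈S z∉ with covers z z∈S
    ... | k , z∈k with k ≟ i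
    ...   | yes refl = contradiction z∈k z∉
    ...   | no k≢i   = trans (across F i k (≢-sym k≢i) u∈ z∈k) (same k k≢i)

  -- With two components, or with three because the representatives span no rainbow triangle, some
  -- component sees all the others in one colour and `isolate` gives a homogeneous split. So there
  -- are at least four, and either they cover `S` or there is a fifth.
  family : ∀ {c S} → Split c S → (∀ d → ¬ HomogeneousSplit d S) →
           Σ[ F ∈ Family c S 4 ] Covers F ⊎ Family c S 5
  family {c} {S} sp no-hom = two (covers-or-extends one)
    where
    open Split sp
    one : Family c S 1
    one = extend record { rep = λ () ; rep∈ = λ () ; separated = λ () } (part⊆ in-part) λ ()
    isolated-colour : (F : Family c S 3) → Covers F → ⊥
    isolated-colour F covers with col (r 0F) (r 1F) ≟ col (r 0F) (r 2F)
                                | col (r 1F) (r 2F) ≟ col (r 0F) (r 1F)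
      where r = rep F
    ... | yes 01≡02 | _ = no-hom _ (isolate F covers 0F 1F (λ ()) λ
      { zero 0≢0 → contradiction refl 0≢0
      ; (suc zero) _ → 01≡02
      ; (suc (suc zero)) _ → refl })
    ... | no _ | yes 12≡01 = no-hom _ (isolate F covers 1F 0F (λ ()) λ
      { zero _ → trans (col-sym _ _) (sym 12≡01)
      ; (suc zero) 1≢1 → contradiction refl 1≢1
      ; (suc (suc zero)) _ → refl })
    ... | no 01≢02 | no 12≢01 = no-hom _ (isolate F covers 2F 0F (λ ()) λ
      { zero _ → trans (col-sym _ _) (trans 02≡12 (col-sym _ _))
      ; (suc zero) _ → refl
      ; (suc (suc zero)) 2≢2 → contradiction refl 2≢2 })
      where
      02≡12 = non-rainbow (rep-injective F 0F 1F λ ()) (rep-injective F 0F 2F λ ())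
                          (rep-injective F 1F 2F λ ()) 01≢02 12≢01
    four : (F : Family c S 4) → Covers F ⊎ Family c S 5 →
           Σ[ F ∈ Family c S 4 ] Covers F ⊎ Family c S 5
    four F (inj₁ covers) = inj₁ (F , covers)
    four F (inj₂ F₅)     = inj₂ F₅
    three : (F : Family c S 3) → Covers F ⊎ Family c S 4 →
            Σ[ F ∈ Family c S 4 ] Covers F ⊎ Family c S 5
    three F (inj₁ covers) = contradiction covers (isolated-colour F)
    three F (inj₂ F₄)     = four F₄ (covers-or-extends F₄)
    two : Covers one ⊎ Family c S 2 → Σ[ F ∈ Family c S 4 ] Covers F ⊎ Family c S 5
    two (inj₁ covers) with covers _ out-S
    ... | zero , out∈ = contradiction
      (Component.least (comp one zero) part in-part part-closed out∈) out-part
    two (inj₂ F₂) with covers-or-extends F₂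
    ... | inj₂ F₃     = three F₃ (covers-or-extends F₃)
    ... | inj₁ covers = ⊥-elim (no-hom _ (isolate F₂ covers 0F 1F (λ ()) λ
      { zero 0≢0 → contradiction refl 0≢0 ; (suc zero) _ → refl }))

  -- Excluding four or more components

  N : Fin 3 → Fin n → Fin n → VSet n
  N d x y = ⟪ (λ z → ¬? (z ≟ x) ×-dec ¬? (z ≟ y) ×-dec (col x z ≟ d ⊎-dec col y z ≟ d)) ⟫

  -- The bound 7 instead of 8 allows for the loss of one vertex: the module serves both the whole
  -- vertex set and the complement of an apex.
  module Crowded (S : VSet n) (∣S∣≤22 : count S ≤ 22)
    (crowded : ∀ x y d → x ∈ S → y ∈ S → x ≢ y → d ≢ col x y → 7 ≤ count (S ∩ N d x y)) where

    -- The 7 vertices given by `crowded` for colour `c` are joined to `x` or `y` in colour `c`, so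
    -- closure keeps them in `U`; `x` and `y` make 9.
    closed≥9 : ∀ {c} U → Closed c S U → U ⊆ S → ∀ {x y} → x ∈ U → y ∈ U → x ≢ y →
               col x y ≢ c → 9 ≤ count U
    closed≥9 {c} U cl U⊆S {x} {y} x∈U y∈U x≢y xy≢c = ℕ.≤-trans
      (s≤s (ℕ.≤-trans (s≤s (crowded x y c (U⊆S x∈U) (U⊆S y∈U) x≢y (≢-sym xy≢c)))
        (count-insert (S ∩ N c x y) (U ∖ ⁅ x ⁆) (y∈U , ≢-sym x≢y)
          (λ (_ , _ , y≢y , _) → y≢y refl) inside)))
      (count-insert (U ∖ ⁅ x ⁆) U x∈U (λ (_ , x≢x) → x≢x refl) proj₁)
      where
      inside : S ∩ N c x y ⊆ U ∖ ⁅ x ⁆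
      inside {z} (z∈S , z≢x , _ , e) = decidable-stable (z ∈? U)
        (λ z∉U → [ cl x z x∈U z∈S z∉U , cl y z y∈U z∈S z∉U ]′ e) , z≢x

    module _ {c m} (F : Family c S m) where
      size : Fin m → ℕ
      size i = count (body F i)

      -- The union of two components is closed and contains their representatives, whose edge is not
      -- of colour `c`.
      pair≥9 : ∀ i j → i ≢ j → 9 ≤ size i + size j
      pair≥9 i j i≢j = ℕ.≤-trans
        (closed≥9 (body F i ∪ body F j) cl [ body⊆ F i , body⊆ F j ]′
          (inj₁ (centre F i)) (inj₂ (centre F j)) (rep-injective F i j i≢j) (across≢ F i j i≢j))
        (count-∪ (body F i ∪ body F j) (body F i) (body F j) (λ p → p))
        where
        cl : Closed c S (body F i ∪ body F j)
        cl u z (inj₁ u∈) z∈S z∉ = closed F i u z u∈ z∈S (z∉ ∘ inj₁)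
        cl u z (inj₂ u∈) z∈S z∉ = closed F j u z u∈ z∈S (z∉ ∘ inj₂)

    no-five : ∀ {c} → ¬ Family c S 5
    -- Around the 5-cycle of indices every size is counted twice, so `5 * 9 = 45` would be at most
    -- `2 * 22`.
    no-five F = from-no (45 ≤? 44) (ℕ.≤-trans
      (ℕ.+-mono-≤ (pair≥9 F 0F 1F λ ()) (ℕ.+-mono-≤ (pair≥9 F 1F 2F λ ())
        (ℕ.+-mono-≤ (pair≥9 F 2F 3F λ ()) (ℕ.+-mono-≤ (pair≥9 F 3F 4F λ ())
          (pair≥9 F 4F 0F λ ())))))
      (ℕ.≤-trans (ℕ.≤-reflexive (cycle (s 0F) (s 1F) (s 2F) (s 3F) (s 4F))) (ℕ.*-monoʳ-≤ 2 (ℕ.≤-trans (sizes F) ∣S∣≤22))))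
      where
      s = size F
      cycle : ∀ a b c d e → (a + b) + ((b + c) + ((c + d) + ((d + e) + (e + a)))) ≡
                            2 * (a + (b + (c + (d + (e + 0)))))
      cycle = solve-∀

    -- If component 0 were a single vertex, each other one would have at least 8, which is 24 in
    -- all. Otherwise it is a `c`-clique with two vertices `x` and `x′`, and the colour `d` from
    -- `minority` leads from it to at most one component, which must hold all of `S ∩ N d x x′`.
    other≥7 : ∀ {c} (F : Family c S 4) → Covers F → ∃[ j ] 7 ≤ size F (suc j)
    other≥7 {c} F covers
      with any? (λ x′ → x′ ∈? body F 0F ×-dec ¬? (x′ ≟ rep F 0F))
    ... | no none = contradiction (ℕ.≤-trans big (ℕ.≤-trans (sizes F) ∣S∣≤22)) (from-no (24 ≤? 22))
      where
      s = size F
      s₀≤1 : s 0F ≤ 1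
      s₀≤1 = ℕ.≤-trans (count-mono (body F 0F) ⁅ rep F 0F ⁆ (λ {z} z∈ →
        decidable-stable (z ≟ rep F 0F) (λ z≢ → none (z , z∈ , z≢)))) count⁅ rep F 0F ⁆≤1
      rest≥8 : ∀ j → 0F ≢ j → 8 ≤ s j
      rest≥8 j 0≢j = ℕ.≤-pred (ℕ.≤-trans (pair≥9 F 0F j 0≢j) (ℕ.+-monoˡ-≤ (s j) s₀≤1))
      big : 24 ≤ s 0F + (s 1F + (s 2F + (s 3F + 0)))
      big = ℕ.≤-trans (ℕ.+-mono-≤ (rest≥8 1F λ ()) (ℕ.+-mono-≤ (rest≥8 2F λ ())
        (ℕ.+-mono-≤ (rest≥8 3F λ ()) (z≤n {0})))) (ℕ.m≤n+m _ (s 0F))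
    ... | yes (x′ , x′∈ , x′≢x) = j , ℕ.≤-trans
      (crowded x x′ d (rep∈ F 0F) (body⊆ F 0F x′∈) (≢-sym x′≢x)
        (λ e → d≢c (trans e (clique (centre F 0F) x′∈ (≢-sym x′≢x)))))
      (count-mono (S ∩ N d x x′) (body F (suc j)) inside)
      where
      x = rep F 0F
      s = size F
      clique : ∀ {u u′} → u ∈ body F 0F → u′ ∈ body F 0F → u ≢ u′ → col u u′ ≡ c
      clique {u} {u′} u∈ u′∈ u≢u′ = decidable-stable (col u u′ ≟ c) λ uu′≢c →
        -- An edge of another colour gives component 0 at least 9 vertices; twice that plus the
        -- three pairs among the other components is 45, against twice 22.
        from-no (45 ≤? 44) (ℕ.≤-trans
          (ℕ.+-mono-≤ (s₀≥9 uu′≢c) (ℕ.+-mono-≤ (s₀≥9 uu′≢c) (ℕ.+-mono-≤ (pair≥9 F 1F 2F λ ())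
            (ℕ.+-mono-≤ (pair≥9 F 2F 3F λ ()) (pair≥9 F 3F 1F λ ())))))
          (ℕ.≤-trans (ℕ.≤-reflexive (cycle (s 0F) (s 1F) (s 2F) (s 3F)))
            (ℕ.*-monoʳ-≤ 2 (ℕ.≤-trans (sizes F) ∣S∣≤22))))
        where
        s₀≥9 : col u u′ ≢ c → 9 ≤ s 0F
        s₀≥9 = closed≥9 (body F 0F) (closed F 0F) (body⊆ F 0F) u∈ u′∈ u≢u′
        cycle : ∀ a b c d → a + (a + ((b + c) + ((c + d) + (d + b)))) ≡
                            2 * (a + (b + (c + (d + 0))))
        cycle = solve-∀
      minor = minority (λ l → col x (rep F (suc l))) c (λ l → across≢ F 0F (suc l) λ ())
      d = proj₁ minor
      j = proj₁ (proj₂ minor)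
      d≢c = proj₁ (proj₂ (proj₂ minor))
      inside : S ∩ N d x x′ ⊆ body F (suc j)
      inside {z} (z∈S , z≢x , z≢x′ , e) with covers z z∈S
      ... | zero , z∈ = contradiction (
        [ trans (sym (clique (centre F 0F) z∈ (≢-sym z≢x)))
        , trans (sym (clique x′∈ z∈ (≢-sym z≢x′))) ]′ e) (≢-sym d≢c)
      ... | suc l , z∈ = subst (λ i → z ∈ body F (suc i)) (proj₂ (proj₂ (proj₂ minor)) l
        ([ trans (sym (across F 0F (suc l) (λ ()) (centre F 0F) z∈))
         , trans (sym (across F 0F (suc l) (λ ()) x′∈ z∈)) ]′ e)) z∈

    -- Two components have at least 7 vertices each and the remaining two together at least 9, which
    -- makes 23. The second large one is found after moving the first to the front.
    no-four : ∀ {c} (F : Family c S 4) → ¬ Covers F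
    no-four {c} F covers with other≥7 F covers
    ... | j , sⱼ≥7 with other≥7 F′ covers′
      where
      F′ : Family c S 4
      F′ = reindex F (front (suc j)) (front-injective (suc j))
      covers′ : Covers F′
      covers′ z z∈S with covers z z∈S
      ... | k , z∈k with front-surjective (suc j) k
      ...   | i , refl = i , z∈k
    ...   | k , sₖ≥7 = from-no (23 ≤? 22) (ℕ.≤-trans
      (ℕ.+-mono-≤ sⱼ≥7 (ℕ.+-mono-≤ sₖ≥7 (ℕ.≤-trans (pair≥9 F″ 2F 3F λ ())
        (ℕ.+-monoʳ-≤ (size F″ 2F) (ℕ.m≤m+n (size F″ 3F) 0)))))
      (ℕ.≤-trans (sizes F″) ∣S∣≤22))
      where
      -- Lists the two large components first; `k` indexes the family already reordered by
      -- `front (suc j)`, hence the `punchIn (suc j)`.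
      π : Fin 4 → Fin 4
      π zero    = suc j
      π (suc i) = punchIn (suc j) (front k i)
      π-injective : ∀ i i′ → i ≢ i′ → π i ≢ π i′
      π-injective zero    zero     i≢ _ = i≢ refl
      π-injective zero    (suc i′) _  e = Fin.punchInᵢ≢i (suc j) (front k i′) (sym e)
      π-injective (suc i) zero     _  e = Fin.punchInᵢ≢i (suc j) (front k i) e
      π-injective (suc i) (suc i′) i≢ e = front-injective k i i′ (i≢ ∘ cong suc)
        (Fin.punchIn-injective (suc j) _ _ e)
      F″ : Family c S 4
      F″ = reindex F π π-injective

  -- Counting triangles inside the smaller side

  module Side (crowded : ∀ x y d → x ≢ y → d ≢ col x y → 8 ≤ count (N d x y))
    {a} (A : VSet n) (∣A∣≤11 : count A ≤ 11)
    (uniform : ∀ x z → x ∈ A → z ∉ A → col x z ≡ a) where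

    -- Empty when `x` lies outside `A`, so the sums below can run over all vertices.
    E : Fin 3 → Fin n → VSet n
    E d x = ⟪ (λ z → x ∈? A ×-dec z ∈? A ×-dec ¬? (z ≟ x) ×-dec col x z ≟ d) ⟫

    E-sym : ∀ d x z → z ∈ E d x → x ∈ E d z
    E-sym d x z (x∈A , z∈A , z≢x , xz≡d) = z∈A , x∈A , ≢-sym z≢x , trans (col-sym z x) xz≡d

    degree : Fin 3 → Fin n → ℕ
    degree d x = count (E d x)

    -- For distinct `b` and `c`, this is 1 when `w x z` is a path inside `A` with one edge of each
    -- colour, and 0 otherwise. The products let its sum factor at the centre `x`.
    cherry : Fin 3 → Fin 3 → Fin n → Fin n → Fin n → ℕ
    cherry b c x w z = χ (E b x) w * χ (E c x) z + χ (E c x) w * χ (E b x) z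

    cherry-comm : ∀ b c x w z → cherry b c x w z ≡ cherry c b x w z
    cherry-comm b c x w z = ℕ.+-comm (χ (E b x) w * χ (E c x) z) (χ (E c x) w * χ (E b x) z)

    1≤cherry : ∀ {b c x w z} → w ∈ E b x → z ∈ E c x → 1 ≤ cherry b c x w z
    1≤cherry {b} {c} {x} {w} {z} w∈ z∈
      rewrite indicator-yes (w ∈? E b x) w∈ | indicator-yes (z ∈? E c x) z∈ = s≤s z≤n

    1≤cherry′ : ∀ {b c x w z} → w ∈ E c x → z ∈ E b x → 1 ≤ cherry b c x w z
    1≤cherry′ {b} {c} {x} {w} {z} w∈ z∈ =
      subst (1 ≤_) (cherry-comm c b x w z) (1≤cherry {c} {b} {x} {w} {z} w∈ z∈)

    -- One edge has colour `b` and another colour `c`; the last must repeat one of them, which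
    -- leaves three cases.
    triangle : ∀ {b c x w z} → b ≢ c → w ∈ E b x → z ∈ N c x w →
               (col x z ≡ c × col w z ≡ b ⊎ col x z ≡ c × col w z ≡ c) ⊎ col x z ≡ b × col w z ≡ c
    triangle {b} {c} {x} {w} {z} b≢c (_ , _ , w≢x , xw≡b) (z≢x , z≢w , e)
      with col x z ≟ c | col w z ≟ b
    ... | yes xz≡c | yes wz≡b = inj₁ (inj₁ (xz≡c , wz≡b))
    ... | yes xz≡c | no wz≢b  = inj₁ (inj₂ (xz≡c , trans (sym xz≡wz) xz≡c))
      where
      xz≡wz = non-rainbow (≢-sym w≢x) (≢-sym z≢x) (≢-sym z≢w)
        (λ xw≡xz → b≢c (trans (sym xw≡b) (trans xw≡xz xz≡c))) (λ wz≡xw → wz≢b (trans wz≡xw xw≡b))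
    ... | no xz≢c | _ = [ (λ xz≡c → contradiction xz≡c xz≢c) , (λ wz≡c → inj₂ (xz≡b wz≡c , wz≡c)) ]′ e
      where
      wx≡b : col w x ≡ b
      wx≡b = trans (col-sym w x) xw≡b
      xz≡b : col w z ≡ c → col x z ≡ b
      xz≡b wz≡c = decidable-stable (col x z ≟ b) λ xz≢b → xz≢c (trans
        (sym (non-rainbow w≢x (≢-sym z≢w) (≢-sym z≢x)
          (λ wx≡wz → b≢c (trans (sym wx≡b) (trans wx≡wz wz≡c)))
          (λ xz≡wx → xz≢b (trans xz≡wx wx≡b)))) wz≡c)

    cherries : Fin 3 → Fin 3 → Fin n → Fin n → Fin n → ℕ
    cherries b c x w z = (cherry b c x w z + cherry b c w x z) + cherry b c z x w

    -- A triangle in exactly two colours has exactly two bichromatic cherries.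
    two-cherries : ∀ {b c x w z} → b ≢ c → c ≢ a → w ∈ E b x → z ∈ N c x w →
                   2 ≤ cherries b c x w z
    two-cherries {b} {c} {x} {w} {z} b≢c c≢a w∈@(x∈A , w∈A , w≢x , xw≡b) z∈@(z≢x , z≢w , e) =
      [ [ (λ (xz , wz) → combine (1≤cherry {b} {c} {x} {w} {z} w∈ (xE xz)) z≤n
            (1≤cherry′ {b} {c} {z} {x} {w} (E-sym c x z (xE xz)) (E-sym b w z (wE wz))))
        , (λ (xz , wz) → combine (1≤cherry {b} {c} {x} {w} {z} w∈ (xE xz))
            (1≤cherry {b} {c} {w} {x} {z} x∈ (wE wz)) z≤n) ]′
      , (λ (xz , wz) → combine z≤n (1≤cherry {b} {c} {w} {x} {z} x∈ (wE wz))
            (1≤cherry {b} {c} {z} {x} {w} (E-sym b x z (xE xz)) (E-sym c w z (wE wz)))) ]′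
      (triangle b≢c w∈ z∈)
      where
      x∈ : x ∈ E b w
      x∈ = E-sym b x w w∈
      z∈A : z ∈ A
      z∈A = decidable-stable (z ∈? A) λ z∉A →
        c≢a ([ (λ xz≡c → trans (sym xz≡c) (uniform x z x∈A z∉A))
             , (λ wz≡c → trans (sym wz≡c) (uniform w z w∈A z∉A)) ]′ e)
      xE : ∀ {d} → col x z ≡ d → z ∈ E d x
      xE xz≡d = x∈A , z∈A , z≢x , xz≡d
      wE : ∀ {d} → col w z ≡ d → z ∈ E d w
      wE wz≡d = w∈A , z∈A , z≢w , wz≡d
      combine : ∀ {i j k} → i ≤ cherry b c x w z → j ≤ cherry b c w x z → k ≤ cherry b c z x w →
                i + j + k ≤ cherries b c x w z
      combine p q r = ℕ.+-mono-≤ (ℕ.+-mono-≤ p q) r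

    module Pair {b c} (b≢c : b ≢ c) (b≢a : b ≢ a) (c≢a : c ≢ a) where

      -- Counts an ordered edge `x w` inside `A` of colour `b` or `c` together with a `z` joined to
      -- one of its ends in the other of these colours. Edges leaving `A` have colour `a`, so `z`
      -- lies in `A` too.
      mixed : Fin n → Fin n → Fin n → ℕ
      mixed x w z = χ (E b x) w * χ (N c x w) z + χ (E c x) w * χ (N b x w) z

      2mixed≤cherries : ∀ x w z → 2 * mixed x w z ≤ cherries b c x w z
      2mixed≤cherries x w z = go (w ∈? E b x) (w ∈? E c x) (z ∈? N c x w) (z ∈? N b x w)
        where
        go : (p : Dec (w ∈ E b x)) (q : Dec (w ∈ E c x)) (r : Dec (z ∈ N c x w))
             (s : Dec (z ∈ N b x w)) →
             2 * (indicator p * indicator r + indicator q * indicator s) ≤ cherries b c x w z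
        go (yes (_ , _ , _ , xw≡b)) (yes (_ , _ , _ , xw≡c)) _ _ =
          contradiction (trans (sym xw≡b) xw≡c) b≢c
        go (yes p) (no _) (yes r) _ = two-cherries b≢c c≢a p r
        go (no _) (yes q) _ (yes s) = subst (2 ≤_)
          (cong₂ _+_ (cong₂ _+_ (cherry-comm c b x w z) (cherry-comm c b w x z))
            (cherry-comm c b z x w)) (two-cherries (≢-sym b≢c) b≢a q s)
        go (yes _) (no _) (no _) _ = z≤n
        go (no _) (yes _) _ (no _) = z≤n
        go (no _) (no _) _ _ = z≤n

      total : ℕ
      total = sum λ x → degree b x + degree c x

      products : ℕ
      products = sum λ x → degree b x * degree c x + degree c x * degree b x

      -- `total` counts the ordered edges of colours `b` and `c` inside `A`, and `crowded` gives
      -- each of them at least 8 choices of `z`.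
      8total≤mixed : 8 * total ≤ ∑³ mixed
      8total≤mixed = ℕ.≤-trans
        (ℕ.≤-reflexive (*-distribˡ-sum 8 (λ x → degree b x + degree c x)))
        (sum-mono λ x → ℕ.≤-trans
          (ℕ.≤-reflexive (trans (cong (8 *_) (sym (∑-distrib-+ (χ (E b x)) (χ (E c x)))))
            (*-distribˡ-sum 8 (λ w → χ (E b x) w + χ (E c x) w))))
          (sum-mono (edge x)))
        where
        go : ∀ x w (p : Dec (w ∈ E b x)) (q : Dec (w ∈ E c x)) →
             8 * (indicator p + indicator q) ≤
             indicator p * count (N c x w) + indicator q * count (N b x w)
        go x w (yes (_ , _ , _ , xw≡b)) (yes (_ , _ , _ , xw≡c)) =
          contradiction (trans (sym xw≡b) xw≡c) b≢c
        go x w (yes (_ , _ , w≢x , xw≡b)) (no _) = ℕ.≤-trans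
          (crowded x w c (≢-sym w≢x) (λ e → b≢c (sym (trans e xw≡b))))
          (ℕ.≤-reflexive (identity (count (N c x w))))
          where
          identity : ∀ k → k ≡ 1 * k + 0
          identity = solve-∀
        go x w (no _) (yes (_ , _ , w≢x , xw≡c)) = ℕ.≤-trans
          (crowded x w b (≢-sym w≢x) (λ e → b≢c (trans e xw≡c)))
          (ℕ.≤-reflexive (sym (ℕ.*-identityˡ (count (N b x w)))))
        go x w (no _) (no _) = z≤n
        edge : ∀ x w → 8 * (χ (E b x) w + χ (E c x) w) ≤ sum (mixed x w)
        edge x w = ℕ.≤-trans (go x w (w ∈? E b x) (w ∈? E c x)) (ℕ.≤-reflexive (sym (trans
          (∑-distrib-+ (λ z → χ (E b x) w * χ (N c x w) z) (λ z → χ (E c x) w * χ (N b x w) z))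
          (cong₂ _+_ (sym (*-distribˡ-sum (χ (E b x) w) (χ (N c x w))))
                     (sym (*-distribˡ-sum (χ (E c x) w) (χ (N b x w))))))))

      cherry-sum : ∑³ (cherry b c) ≡ products
      cherry-sum = sum-cong-≗ λ x → trans
        (sum-cong-≗ λ w → trans
          (∑-distrib-+ (λ z → χ (E b x) w * χ (E c x) z) (λ z → χ (E c x) w * χ (E b x) z))
          (cong₂ _+_ (sym (*-distribˡ-sum (χ (E b x) w) (χ (E c x))))
                     (sym (*-distribˡ-sum (χ (E c x) w) (χ (E b x))))))
        (trans (∑-distrib-+ (λ w → χ (E b x) w * degree c x) (λ w → χ (E c x) w * degree b x))
          (cong₂ _+_ (sym (*-distribʳ-sum (degree c x) (χ (E b x))))
                     (sym (*-distribʳ-sum (degree b x) (χ (E c x))))))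

      -- Every mixed triple yields two cherries, and each of the three positions of the centre sums
      -- to `products`.
      2mixed≤3products : 2 * ∑³ mixed ≤ products + products + products
      2mixed≤3products = ℕ.≤-trans (ℕ.≤-reflexive double) (ℕ.≤-trans
        (∑³-mono 2mixed≤cherries) (ℕ.≤-reflexive (trans
          (∑³-+ (λ x w z → cherry b c x w z + cherry b c w x z) (λ x w z → cherry b c z x w))
          (cong₂ _+_ (trans (∑³-+ (cherry b c) (λ x w z → cherry b c w x z))
              (cong₂ _+_ cherry-sum (trans (∑³-swap (cherry b c)) cherry-sum)))
            (trans (∑³-rotate (cherry b c)) cherry-sum)))))
        where
        double : 2 * ∑³ mixed ≡ ∑³ (λ x w z → 2 * mixed x w z)
        double = trans (*-distribˡ-sum 2 (λ x → sum λ w → sum (mixed x w)))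
          (sum-cong-≗ λ x → trans (*-distribˡ-sum 2 (λ w → sum (mixed x w)))
            (sum-cong-≗ λ w → *-distribˡ-sum 2 (mixed x w)))

      degrees≤10 : ∀ x → degree b x + degree c x ≤ 10
      degrees≤10 x = go (x ∈? A)
        where
        go : Dec (x ∈ A) → degree b x + degree c x ≤ 10
        go (yes x∈A) = ℕ.≤-trans
          (count-disjoint (E b x) (E c x) (A ∖ ⁅ x ⁆)
            (λ (_ , _ , _ , p) (_ , _ , _ , q) → b≢c (trans (sym p) q))
            (λ (_ , z∈A , z≢x , _) → z∈A , z≢x) (λ (_ , z∈A , z≢x , _) → z∈A , z≢x))
          (ℕ.≤-pred (ℕ.≤-trans (count-insert (A ∖ ⁅ x ⁆) A x∈A (λ p → proj₂ p refl) proj₁) ∣A∣≤11))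
        go (no x∉A) = subst (_≤ 10) (sym (cong₂ _+_
          (count-empty (E b x) (x∉A ∘ proj₁)) (count-empty (E c x) (x∉A ∘ proj₁)))) z≤n

      2products≤10total : 2 * products ≤ 10 * total
      2products≤10total = ℕ.≤-trans
        (ℕ.≤-reflexive (*-distribˡ-sum 2 (λ x → degree b x * degree c x + degree c x * degree b x)))
        (ℕ.≤-trans
          (sum-mono λ x → ℕ.≤-trans (am-gm (degree b x) (degree c x))
            (ℕ.*-monoˡ-≤ (degree b x + degree c x) (degrees≤10 x)))
          (ℕ.≤-reflexive (sym (*-distribˡ-sum 10 (λ x → degree b x + degree c x)))))

      -- Chaining the bounds gives `32 * total ≤ 30 * total`; the constants come from the 8 of
      -- `crowded` and the degree bound 10.
      total≡0 : total ≡ 0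
      total≡0 = ℕ.n≤0⇒n≡0 (ℕ.*-cancelˡ-≤ 2 (ℕ.+-cancelˡ-≤ (30 * total) _ _ (begin
        30 * total + 2 * total               ≡⟨ regroup₁ total ⟩
        2 * (2 * (8 * total))                ≤⟨ ℕ.*-monoʳ-≤ 2 (ℕ.*-monoʳ-≤ 2 8total≤mixed) ⟩
        2 * (2 * ∑³ mixed)                   ≤⟨ ℕ.*-monoʳ-≤ 2 2mixed≤3products ⟩
        2 * (products + products + products) ≡⟨ regroup₂ products ⟩
        3 * (2 * products)                   ≤⟨ ℕ.*-monoʳ-≤ 3 2products≤10total ⟩
        3 * (10 * total)                     ≡⟨ regroup₃ total ⟩
        30 * total + 2 * 0                   ∎)))
        where
        open ℕ.≤-Reasoning
        regroup₁ : ∀ t → 30 * t + 2 * t ≡ 2 * (2 * (8 * t))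
        regroup₁ = solve-∀
        regroup₂ : ∀ p → 2 * (p + p + p) ≡ 3 * (2 * p)
        regroup₂ = solve-∀
        regroup₃ : ∀ t → 3 * (10 * t) ≡ 30 * t + 2 * 0
        regroup₃ = solve-∀

      no-edge : ∀ x w → w ∉ E b x
      no-edge x w w∈ = contradiction
        (ℕ.≤-trans (∈⇒1≤count (E b x) w∈) (ℕ.≤-trans (ℕ.m≤m+n _ (degree c x))
          (ℕ.≤-trans (term≤sum (λ x → degree b x + degree c x) x) (ℕ.≤-reflexive total≡0)))) λ ()

    monochromatic : ∀ {x w} → x ∈ A → w ∈ A → x ≢ w → col x w ≡ a
    monochromatic {x} {w} x∈A w∈A x≢w = decidable-stable (col x w ≟ a) λ xw≢a →
      let (c , c≢a , c≢xw) = third a (col x w) in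
      Pair.no-edge (≢-sym c≢xw) xw≢a c≢a x w (x∈A , w∈A , ≢-sym x≢w , refl)

    -- Two distinct vertices of `A` would have all their edges in colour `a`, leaving `N d x w`
    -- empty for `d` other than `a`.
    singleton : ∀ {x w} → x ∈ A → w ∈ A → x ≡ w
    singleton {x} {w} x∈A w∈A = decidable-stable (x ≟ w) λ x≢w →
      let (d , _ , _ , d≢a , _) = others a
          (z , z≢x , z≢w , e) = inhabited (N d x w) (ℕ.≤-trans (s≤s z≤n)
            (crowded x w d x≢w (λ e → d≢a (trans e (monochromatic x∈A w∈A x≢w)))))
      in d≢a ([ (λ xz≡d → trans (sym xz≡d) (to-a x∈A z≢x))
              , (λ wz≡d → trans (sym wz≡d) (to-a w∈A z≢w)) ]′ e)
      where
      to-a : ∀ {y z} → y ∈ A → z ≢ y → col y z ≡ a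
      to-a {y} {z} y∈A z≢y with z ∈? A
      ... | yes z∈A = monochromatic y∈A z∈A (≢-sym z≢y)
      ... | no z∉A  = uniform y z y∈A z∉A

  -- An apex vertex and the final contradiction

  module NoBook (n≤22 : n ≤ 22)
    (crowded : ∀ x y d → x ≢ y → d ≢ col x y → 8 ≤ count (N d x y)) where

    module Apex {v a} (to-v : ∀ z → z ≢ v → col v z ≡ a) where

      S : VSet n
      S = ∁ ⁅ v ⁆

      ∣S∣≤21 : count S ≤ 21
      ∣S∣≤21 = ℕ.≤-pred (ℕ.≤-trans (count-insert {x = v} S full tt (λ v≢v → v≢v refl) (λ _ → tt))
        (ℕ.≤-trans (count≤n (full {n})) n≤22))

      D : Fin 3 → Fin n → VSet n
      D d y = ⟪ (λ z → ¬? (z ≟ y) ×-dec col y z ≟ d) ⟫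

      -- Apply `crowded` to the edge `v y`: all edges at `v` have colour `a`, so the eight vertices
      -- are `d`-neighbours of `y`.
      degree≥8 : ∀ {d y} → y ∈ S → d ≢ a → 8 ≤ count (S ∩ D d y)
      degree≥8 {d} {y} y≢v d≢a = ℕ.≤-trans
        (crowded v y d (≢-sym y≢v) (λ e → d≢a (trans e (to-v y y≢v))))
        (count-mono (N d v y) (S ∩ D d y) λ {z} (z≢v , z≢y , e) → z≢v , z≢y ,
          [ (λ vz≡d → contradiction (trans (sym vz≡d) (to-v z z≢v)) d≢a) , (λ yz≡d → yz≡d) ]′ e)

      crowded-S : ∀ x y d → x ∈ S → y ∈ S → x ≢ y → d ≢ col x y → 7 ≤ count (S ∩ N d x y)
      crowded-S x y d _ _ x≢y d≢xy = ℕ.≤-pred (ℕ.≤-trans (crowded x y d x≢y d≢xy)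
        (ℕ.≤-trans (count-∪ (N d x y) ⁅ v ⁆ (S ∩ N d x y) cover) (ℕ.+-monoˡ-≤ _ count⁅ v ⁆≤1)))
        where
        cover : ∀ {z} → z ∈ N d x y → z ∈ ⁅ v ⁆ ⊎ z ∈ S ∩ N d x y
        cover {z} z∈N with z ≟ v
        ... | yes z≡v = inj₁ z≡v
        ... | no z≢v  = inj₂ (z≢v , z∈N)

      neighbours-inside : ∀ {d d′ u} U → (∀ u z → u ∈ U → z ∈ S → z ∉ U → col u z ≡ d) →
                          u ∈ U → d′ ≢ d → S ∩ D d′ u ⊆ U
      neighbours-inside {u = u} U uniform u∈U d′≢d {z} (z∈S , _ , uz≡d′) =
        decidable-stable (z ∈? U) λ z∉U → d′≢d (trans (sym uz≡d′) (uniform u z u∈U z∈S z∉U))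

      part≥12 : ∀ {d u} U → U ⊆ S → u ∈ U → (∀ u z → u ∈ U → z ∈ S → z ∉ U → col u z ≡ d) →
                12 ≤ count U
      part≥12 {d} {u} U U⊆S u∈U uniform with d ≟ a
      -- Neither of the colours `b` and `c` leaves `U`, so `u` has 8 + 8 neighbours there.
      ... | yes refl = let (b , c , b≢c , b≢a , c≢a) = others a in
        ℕ.≤-trans (ℕ.m≤m+n 12 4) (ℕ.≤-trans
          (ℕ.+-mono-≤ (degree≥8 (U⊆S u∈U) b≢a) (degree≥8 (U⊆S u∈U) c≢a))
          (count-disjoint (S ∩ D b u) (S ∩ D c u) U
            (λ (_ , _ , uz≡b) (_ , _ , uz≡c) → b≢c (trans (sym uz≡b) uz≡c))
            (neighbours-inside U uniform u∈U b≢a) (neighbours-inside U uniform u∈U c≢a)))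
      ... | no d≢a with third a d
      ...   | c , c≢a , c≢d with inhabited (S ∩ D c u) (ℕ.≤-trans (s≤s z≤n) (degree≥8 (U⊆S u∈U) c≢a))
      -- At least 7 vertices of `U` are `a`-neighbours of `u` or `y`, and each of these two ends has
      -- 8 further `c`-neighbours in `U`. So `7 + 16 = 23` is at most twice the size of `U`, which
      -- rules out 11.
      ...     | y , y∈@(y∈S , y≢u , uy≡c) = ℕ.≰⇒> λ ∣U∣≤11 → from-no (23 ≤? 22) (ℕ.≤-trans
        (ℕ.+-monoˡ-≤ 16 near)
        (ℕ.≤-trans (ℕ.≤-reflexive (regroup (count (U ∩ D a u)) (count (U ∩ D a y))))
          (ℕ.+-mono-≤ (ℕ.≤-trans (degree u∈U) ∣U∣≤11) (ℕ.≤-trans (degree y∈U) ∣U∣≤11))))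
        where
        y∈U : y ∈ U
        y∈U = neighbours-inside U uniform u∈U c≢d y∈
        near : 7 ≤ count (U ∩ D a u) + count (U ∩ D a y)
        near = ℕ.≤-trans
          (crowded-S u y a (U⊆S u∈U) y∈S (≢-sym y≢u) (λ e → c≢a (trans (sym uy≡c) (sym e))))
          (count-∪ (S ∩ N a u y) (U ∩ D a u) (U ∩ D a y) λ (z∈S , z≢u , z≢y , e) →
            [ (λ uz≡a → inj₁ (neighbours-inside U uniform u∈U (≢-sym d≢a) (z∈S , z≢u , uz≡a) , z≢u , uz≡a))
            , (λ yz≡a → inj₂ (neighbours-inside U uniform y∈U (≢-sym d≢a) (z∈S , z≢y , yz≡a) , z≢y , yz≡a)) ]′ e)
        degree : ∀ {w} → w ∈ U → count (U ∩ D a w) + 8 ≤ count U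
        degree {w} w∈U = ℕ.≤-trans
          (ℕ.+-monoʳ-≤ (count (U ∩ D a w)) (degree≥8 (U⊆S w∈U) c≢a))
          (count-disjoint (U ∩ D a w) (S ∩ D c w) U
            (λ (_ , _ , wz≡a) (_ , _ , wz≡c) → c≢a (trans (sym wz≡c) wz≡a))
            proj₁ (neighbours-inside U uniform w∈U c≢d))
        regroup : ∀ p q → (p + q) + 16 ≡ (p + 8) + (q + 8)
        regroup = solve-∀

      no-homogeneous-split : ∀ d → ¬ HomogeneousSplit d S
      no-homogeneous-split d h = from-no (24 ≤? 21) (ℕ.≤-trans
        (ℕ.+-mono-≤ (part≥12 part part⊆ in-part uniform)
          (part≥12 (S ∖ part) proj₁ (out-S , out-part) λ u z (u∈S , u∉) z∈S z∉ →
            trans (col-sym u z)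
              (uniform z u (decidable-stable (z ∈? part) (λ z∉p → z∉ (z∈S , z∉p))) u∈S u∉)))
        (ℕ.≤-trans (count-disjoint part (S ∖ part) S (λ p q → proj₂ q p) part⊆ proj₁) ∣S∣≤21))
        where open HomogeneousSplit h

      no-apex : ∀ {y} → y ≢ v → ⊥
      no-apex {y} y≢v =
        let (b , _ , _ , b≢a , _) = others a
            (w , w≢v , w≢y , _) = inhabited (S ∩ D b y) (ℕ.≤-trans (s≤s z≤n) (degree≥8 y≢v b≢a))
        in some-split S y≢v w≢v (≢-sym w≢y) λ c split →
          [ (λ (F , covers) → no-four F covers) , no-five ]′ (family split no-homogeneous-split)
        where open Crowded S (ℕ.≤-trans ∣S∣≤21 (ℕ.m≤m+n 21 1)) crowded-S

    no-small-side : ∀ {a x y} (A : VSet n) → count A ≤ 11 → x ∈ A → y ∉ A →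
                    (∀ x z → x ∈ A → z ∉ A → col x z ≡ a) → ⊥
    no-small-side {a} {x} {y} A ∣A∣≤11 x∈A y∉A uniform =
      Apex.no-apex {x} {a} (λ z z≢x → uniform x z x∈A (λ z∈A → z≢x (singleton z∈A x∈A))) {y}
        (λ y≡x → y∉A (subst (_∈ A) (sym y≡x) x∈A))
      where open Side crowded A ∣A∣≤11 uniform

    -- Since `n ≤ 22`, either `part` or its complement has at most 11 vertices, and homogeneity is
    -- symmetric in the two sides.
    no-homogeneous-split : ∀ d → ¬ HomogeneousSplit d full
    no-homogeneous-split d h with count part ≤? 11
      where open HomogeneousSplit h
    ... | yes ∣part∣≤11 = no-small-side part ∣part∣≤11 in-part out-part (λ x z x∈ → uniform x z x∈ tt)
      where open HomogeneousSplit h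
    ... | no ∣part∣≰11 = no-small-side (∁ part)
      (ℕ.+-cancelˡ-≤ 11 _ _ (ℕ.≤-trans (ℕ.+-monoˡ-≤ _ (ℕ.<⇒≤ (ℕ.≰⇒> ∣part∣≰11))) (ℕ.≤-trans
        (count-disjoint part (∁ part) full (λ p q → q p) (λ _ → tt) (λ _ → tt))
        (ℕ.≤-trans (count≤n (full {n})) n≤22))))
      out-part (λ q → q in-part)
      (λ x z x∉ z∉∉ → trans (col-sym x z)
        (uniform z x (decidable-stable (z ∈? part) z∉∉) tt x∉))
      where open HomogeneousSplit h

    contradictory : ∀ {x y : Fin n} → x ≢ y → ⊥
    contradictory x≢y = some-split full tt tt x≢y λ c split →
      [ (λ (F , covers) → no-four F covers) , no-five ]′ (family split no-homogeneous-split)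
      where
      open Crowded full (ℕ.≤-trans (count≤n (full {n})) n≤22)
        (λ x y d _ _ x≢y d≢xy → ℕ.≤-trans (ℕ.≤-trans (ℕ.m≤m+n 7 1) (crowded x y d x≢y d≢xy))
          (count-mono (N d x y) (full ∩ N d x y) (λ p → tt , p)))

-- Pages, books and the upper bound

Pages : ∀ {n} → Coloring 3 n → Fin 3 → Fin n → Fin n → VSet n
Pages f c x y = ⟪ (λ z → ¬? (z ≟ x) ×-dec ¬? (z ≟ y) ×-dec
                         ¬? (color f x z ≟ c) ×-dec ¬? (color f y z ≟ c)) ⟫

-- Spine and pages all avoid `c`, so the colours used lie in the complement of `c`, a set of size 2.
copy : ∀ {n m} (f : Coloring 3 n) {x y c} → x ≢ y → c ≢ color f x y → m ≤ count (Pages f c x y) →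
       Σ[ φ ∈ Copy (book m) n ] UsesAtMost 2 f φ
copy {n} {m} f {x} {y} {c} x≢y c≢xy m≤ = record { embed = e ; injective = e-injective } ,
  Subset.∁ Subset.⁅ c ⁆ ,
  ℕ.≤-reflexive (trans (Subset.∣∁p∣≡n∸∣p∣ Subset.⁅ c ⁆) (cong (3 ∸_) (Subset.∣⁅x⁆∣≡1 c))) ,
  λ { d (u , v , adj , refl) → Subset.x∉p⇒x∈∁p (avoids u v adj ∘ Subset.x∈⁅y⁆⇒x≡y c) }
  where
  chosen = select (Pages f c x y) m≤
  g = proj₁ chosen
  g∈ = proj₂ (proj₂ chosen)
  e : Vertex (book m) → Fin n
  e (inj₁ zero)       = x
  e (inj₁ (suc zero)) = y
  e (inj₂ i)          = g i
  e-injective : Injective _≡_ _≡_ e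
  e-injective {inj₁ zero}       {inj₁ zero}       _ = refl
  e-injective {inj₁ zero}       {inj₁ (suc zero)} p = contradiction p x≢y
  e-injective {inj₁ (suc zero)} {inj₁ zero}       p = contradiction (sym p) x≢y
  e-injective {inj₁ (suc zero)} {inj₁ (suc zero)} _ = refl
  e-injective {inj₁ zero}       {inj₂ i}          p = contradiction (sym p) (proj₁ (g∈ i))
  e-injective {inj₁ (suc zero)} {inj₂ i}          p = contradiction (sym p) (proj₁ (proj₂ (g∈ i)))
  e-injective {inj₂ i}          {inj₁ zero}       p = contradiction p (proj₁ (g∈ i))
  e-injective {inj₂ i}          {inj₁ (suc zero)} p = contradiction p (proj₁ (proj₂ (g∈ i)))
  e-injective {inj₂ i}          {inj₂ j}          p = cong inj₂ (proj₁ (proj₂ chosen) p)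
  spine-page : ∀ s i → color f (e (inj₁ s)) (g i) ≢ c
  spine-page zero       i = proj₁ (proj₂ (proj₂ (g∈ i)))
  spine-page (suc zero) i = proj₂ (proj₂ (proj₂ (g∈ i)))
  avoids : ∀ u v → Adj (book m) u v → color f (e u) (e v) ≢ c
  avoids (inj₁ zero)       (inj₁ zero)       0≢0 = contradiction refl 0≢0
  avoids (inj₁ zero)       (inj₁ (suc zero)) _   = ≢-sym c≢xy
  avoids (inj₁ (suc zero)) (inj₁ zero)       _   = λ p → c≢xy (trans (sym p) (Coloring.sym f y x))
  avoids (inj₁ (suc zero)) (inj₁ (suc zero)) 1≢1 = contradiction refl 1≢1
  avoids (inj₁ s)          (inj₂ i)          _   = spine-page s i
  avoids (inj₂ i)          (inj₁ s)          _   =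
    spine-page s i ∘ trans (Coloring.sym f (e (inj₁ s)) (g i))

-- With `n` a variable between two bounds, counts over `Fin n` stay symbolic.
upper : ∀ {n} {x y : Fin n} → x ≢ y → 22 ≤ n → n ≤ 22 → GallaiArrows 3 2 (book 13) n
upper {n} x≢y 22≤n n≤22 f gallai
  with any? (λ x → any? λ y → any? λ c →
         ¬? (x ≟ y) ×-dec ¬? (c ≟ color f x y) ×-dec 13 ≤? count (Pages f c x y))
... | yes (x , y , c , x≢y , c≢xy , 13≤) = copy f x≢y c≢xy 13≤
... | no none = contradiction x≢y (NoBook.contradictory n≤22 crowded)
  where
  open GallaiColoring f gallai
  crowded : ∀ x y d → x ≢ y → d ≢ color f x y → 8 ≤ count (N d x y)
  -- `14` is the two spine vertices plus at most 12 pages; the remaining vertices, at least 8, lie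
  -- in `N d x y`.
  crowded x y d x≢y d≢xy = ℕ.+-cancelˡ-≤ 14 _ _ (ℕ.≤-trans 22≤n (ℕ.≤-trans
    (injective⇒≤count full (λ z → z) (λ e → e) (λ _ → tt))
    (ℕ.≤-trans (count-∪ full (⁅ x ⁆ ∪ ⁅ y ⁆) (Pages f d x y ∪ N d x y) (λ {z} _ → cover z))
      (ℕ.≤-trans (ℕ.+-mono-≤
        (ℕ.≤-trans (count-∪ (⁅ x ⁆ ∪ ⁅ y ⁆) ⁅ x ⁆ ⁅ y ⁆ (λ p → p))
          (ℕ.+-mono-≤ count⁅ x ⁆≤1 count⁅ y ⁆≤1))
        (ℕ.≤-trans (count-∪ (Pages f d x y ∪ N d x y) (Pages f d x y) (N d x y) (λ p → p))
          (ℕ.+-monoˡ-≤ (count (N d x y)) (ℕ.≤-pred (ℕ.≰⇒> λ 13≤ →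
            none (x , y , d , x≢y , d≢xy , 13≤))))))
        ℕ.≤-refl))))
    where
    cover : ∀ z → (z ≡ x ⊎ z ≡ y) ⊎ (z ∈ Pages f d x y ⊎ z ∈ N d x y)
    cover z with z ≟ x | z ≟ y | color f x z ≟ d | color f y z ≟ d
    ... | yes z≡x | _ | _ | _ = inj₁ (inj₁ z≡x)
    ... | no _ | yes z≡y | _ | _ = inj₁ (inj₂ z≡y)
    ... | no z≢x | no z≢y | yes xz≡d | _ = inj₂ (inj₂ (z≢x , z≢y , inj₁ xz≡d))
    ... | no z≢x | no z≢y | no _ | yes yz≡d = inj₂ (inj₂ (z≢x , z≢y , inj₂ yz≡d))
    ... | no z≢x | no z≢y | no xz≢d | no yz≢d = inj₂ (inj₁ (z≢x , z≢y , xz≢d , yz≢d))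

-- The colouring of `K₂₁` and the lower bound

pentagon : Fin 5 → Fin 5 → Fin 3
pentagon x y = lookup (lookup t x) y
  where
  -- Cyclic distance 1 gets colour 1 and distance 2 gets colour 2; the diagonal 0 becomes the colour
  -- inside each blown-up class.
  t : Vec (Vec (Fin 3) 5) 5
  t = (# 0 ∷ # 1 ∷ # 2 ∷ # 2 ∷ # 1 ∷ []) ∷
      (# 1 ∷ # 0 ∷ # 1 ∷ # 2 ∷ # 2 ∷ []) ∷
      (# 2 ∷ # 1 ∷ # 0 ∷ # 1 ∷ # 2 ∷ []) ∷
      (# 2 ∷ # 2 ∷ # 1 ∷ # 0 ∷ # 1 ∷ []) ∷
      (# 1 ∷ # 2 ∷ # 2 ∷ # 1 ∷ # 0 ∷ []) ∷ []

-- Vertex 0 is the apex; residues modulo 5 sort the other twenty into five classes of four.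
colour₂₁ : Fin 21 → Fin 21 → Fin 3
colour₂₁ zero y = # 0
colour₂₁ (suc x) zero = # 0
colour₂₁ (suc x) (suc y) = pentagon (toℕ x mod 5) (toℕ y mod 5)

colour₂₁-sym : ∀ x y → colour₂₁ x y ≡ colour₂₁ y x
colour₂₁-sym = from-yes (all? λ x → all? λ y → colour₂₁ x y ≟ colour₂₁ y x)

extremal : Coloring 3 21
extremal = record { color = colour₂₁ ; sym = colour₂₁-sym }

no-rainbow? : Dec (∀ x y z → ¬ (colour₂₁ x y ≢ colour₂₁ x z ×
                                colour₂₁ x y ≢ colour₂₁ y z ×
                                colour₂₁ x z ≢ colour₂₁ y z))
no-rainbow? = all? λ x → all? λ y → all? λ z → ¬? (
  ¬? (colour₂₁ x y ≟ colour₂₁ x z) ×-dec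
  ¬? (colour₂₁ x y ≟ colour₂₁ y z) ×-dec
  ¬? (colour₂₁ x z ≟ colour₂₁ y z))

extremal-gallai : IsGallai extremal
extremal-gallai x y z (_ , rainbow) = from-yes no-rainbow? x y z rainbow

-- A finite check. The value 12 occurs for a spine between two classes with colour 0 avoided: its
-- pages are the three other classes.
few-pages? : Dec (∀ c x y → x ≢ y → c ≢ colour₂₁ x y → count (Pages extremal c x y) ≤ 12)
few-pages? = all? λ c → all? λ x → all? λ y →
  ¬? (x ≟ y) →-dec ¬? (c ≟ colour₂₁ x y) →-dec count (Pages extremal c x y) ≤? 12

few-pages : ∀ c x y → x ≢ y → c ≢ colour₂₁ x y → count (Pages extremal c x y) ≤ 12
few-pages = from-yes few-pages?

lower : ∀ q → GallaiArrows 3 2 (book 13) q → 22 ≤ q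
lower q arrows = ℕ.≰⇒> impossible
  where
  impossible : ¬ (q ≤ 21)
  impossible q≤21 with arrows f gallai
    where
    -- Restricting the one colouring to `q` vertices handles every `q ≤ 21`.
    ι : Fin q → Fin 21
    ι z = inject≤ z q≤21
    ι-injective : ∀ {x y} → ι x ≡ ι y → x ≡ y
    ι-injective = Fin.inject≤-injective q≤21 q≤21 _ _
    f : Coloring 3 q
    f = record { color = λ x y → colour₂₁ (ι x) (ι y) ; sym = λ x y → colour₂₁-sym (ι x) (ι y) }
    gallai : IsGallai f
    gallai x y z ((x≢y , x≢z , y≢z) , rainbow) = extremal-gallai (ι x) (ι y) (ι z)
      ((x≢y ∘ ι-injective , x≢z ∘ ι-injective , y≢z ∘ ι-injective) , rainbow)
  ... | φ , T , ∣T∣≤2 , uses with any? (λ c → ¬? (c Subset.∈? T))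
  ...   | no none = from-no (3 ≤? 2) (ℕ.≤-trans
    (Subset.p⊆q⇒∣p∣≤∣q∣ {p = Subset.⊤ {3}} {q = T} (λ {c} _ →
      decidable-stable (c Subset.∈? T) (λ c∉T → none (c , c∉T)))) ∣T∣≤2)
  -- The colour `c` is missing from `T`, so the spine and all 13 pages avoid it, one page too many.
  ...   | yes (c , c∉T) = from-no (13 ≤? 12) (ℕ.≤-trans
    (injective⇒≤count (Pages extremal c x y) (e ∘ inj₂) (inj₂-injective ∘ e-injective)
      (λ i → (λ p → distinct i (e-injective p)) , (λ p → distinct i (e-injective p))
           , (λ p → unused {inj₁ 0F} {inj₂ i} tt p) , (λ p → unused {inj₁ 1F} {inj₂ i} tt p)))
    (few-pages c x y (λ p → 0≢1 (e-injective p)) (λ p → unused {inj₁ 0F} {inj₁ 1F} (λ ()) (sym p))))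
    where
    e : Vertex (book 13) → Fin 21
    e v = inject≤ (embed φ v) q≤21
    x = e (inj₁ 0F)
    y = e (inj₁ 1F)
    e-injective : ∀ {u v} → e u ≡ e v → u ≡ v
    e-injective p = Copy.injective φ (Fin.inject≤-injective q≤21 q≤21 _ _ p)
    distinct : ∀ i {s : Fin 2} → inj₂ i ≢ inj₁ s
    distinct i ()
    0≢1 : _≢_ {A = Vertex (book 13)} (inj₁ 0F) (inj₁ 1F)
    0≢1 ()
    unused : ∀ {u v} → Adj (book 13) u v → colour₂₁ (e u) (e v) ≢ c
    unused adj p = c∉T (uses c (_ , _ , adj , p))

theorem4p9 : IsWeakenedGallaiRamsey 3 2 (book 13) 22
theorem4p9 = upper {x = # 0} {y = # 1} (λ ()) ℕ.≤-refl ℕ.≤-refl , lower
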